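{- Let $r\ge 3$, $k\ge 1$ and $n\ge 1$ be integers. Then $$ex_r^{\mathrm{lin}}(n,S_k^r)\le \frac{n(k-1)}{r}.$$ Moreover, equality is characterized as follows: a linear $r$-uniform hypergraph $H$ on $n$ vertices is $S_k^r$-free with $|E(H)|=\frac{n(k-1)}{r}$ if and only if $H$ is $(k-1)$-regular (so equality is attained exactly when an $n$-vertex linear $r$-uniform $(k-1)$-regular hypergraph exists).
   Context: All hypergraphs are finite. A hypergraph is $r$-uniform if each hyperedge has exactly $r$ vertices, and linear if any two distinct hyperedges intersect in at most one vertex. The degree $d(v)$ of a vertex is the number of hyperedges containing it; $H$ is $d$-regular if every vertex has degree $d$. A hypergraph $H$ contains $F$ as a subhypergraph if there is an injective map $V(F)\to V(H)$ sending every hyperedge of $F$ to a hyperedge of $H$; otherwise $H$ is $F$-free. The linear Turán number $ex_r^{\mathrm{lin}}(n,F)$ is the maximum number of hyperedges in an $F$-free linear $r$-uniform hypergraph on $n$ vertices. The expansion $G^r$ of a graph $G$ is the $r$-uniform hypergraph obtained by enlarging each edge of $G$ with $r-2$ new vertices, the new vertices for different edges being distinct. $S_k$ is the star with $k$ edges and $S_k^r$ is its expansion, i.e. $k$ hyperedges of size $r$ sharing one common vertex and otherwise pairwise disjoint. -}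

module Defs where

open import Data.Bool using (Bool; true; false; if_then_else_)
import Data.Bool.Properties as Bool
open import Data.Fin using (Fin; zero; suc; funToFin; finToFun)
open import Data.Fin.Properties using (_≟_; all?; any?; injective⇒≤; finToFun-funToFin)
open import Data.Fin.Subset using (Subset; inside; _∈_; _∩_; ∣_∣; ⁅_⁆)
open import Data.Fin.Subset.Properties using (_∈?_; anySubset?; ∣⁅x⁆∣≡1; x∈⁅x⁆; x∈⁅y⁆⇒x≡y)
open import Data.Nat using (ℕ; zero; suc; _+_; _*_; _∸_; _^_; _≤_; z≤n)
import Data.Nat.Properties as ℕ
open import Data.Product using (Σ; ∃; ∃-syntax; _×_; _,_; proj₁; proj₂)
open import Data.Sum using (inj₁; inj₂)
open import Data.Vec using (Vec; []; _∷_; _++_; concat; lookup; map; replicate; tabulate)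
open import Data.Vec.Properties
  using (≡-dec; lookup∘tabulate; tabulate-cong; tabulate∘lookup; ++-injectiveˡ; ∷-injectiveʳ)
open import Function using (_∘_)
open import Function.Definitions using (Injective)
open import Level using (0ℓ)
open import Relation.Binary.Definitions using (DecidableEquality)
open import Relation.Binary.PropositionalEquality
open import Relation.Nullary using (¬_; Dec; yes; no; does; contradiction; ¬?; _×-dec_; _→-dec_)
open import Relation.Nullary.Decidable using (map′)
open import Relation.Unary using (Pred; Decidable)

-- The hyperedges form a set: they are indexed by Fin size without repetition.
record Hypergraph (n : ℕ) : Set where
  field
    size           : ℕ
    edge           : Fin size → Subset n
    edge-injective : Injective _≡_ _≡_ edge

open Hypergraph public

private
  variable
    m n q : ℕ

Uniform : ℕ → Hypergraph n → Set
Uniform r H = ∀ i → ∣ edge H i ∣ ≡ r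

Linear : Hypergraph n → Set
Linear H = ∀ i j → i ≢ j → ∣ edge H i ∩ edge H j ∣ ≤ 1

incident : (H : Hypergraph n) → Fin n → Subset (size H)
incident H v = tabulate λ i → lookup (edge H i) v

degree : Hypergraph n → Fin n → ℕ
degree H v = ∣ incident H v ∣

Regular : ℕ → Hypergraph n → Set
Regular d H = ∀ v → degree H v ≡ d

image : (Fin m → Fin n) → Subset m → Subset n
image f p = tabulate λ w → does (any? λ v → (v ∈? p) ×-dec (f v ≟ w))

Contains : Hypergraph n → Hypergraph m → Set
Contains {n} {m} H F =
  ∃[ f ] Injective _≡_ _≡_ f × (∀ i → ∃[ j ] image {m} {n} f (edge F i) ≡ edge H j)

Free : Hypergraph m → Hypergraph n → Set
Free F H = ¬ Contains H F

record Graph (n : ℕ) : Set where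
  field
    hypergraph : Hypergraph n
    2-uniform  : Uniform 2 hypergraph

open Graph public

-- The q * s new vertices come in q consecutive blocks of s; block i is the
-- set of new vertices given to edge i.
block : ∀ s → Fin q → Subset (q * s)
block s i = concat (map (replicate s) ⁅ i ⁆)

expansion : (r : ℕ) (G : Graph m) → Hypergraph (m + size (hypergraph G) * (r ∸ 2))
expansion r G = record
  { size           = size H
  ; edge           = λ i → edge H i ++ block (r ∸ 2) i
  ; edge-injective = λ {i} {j} eq → edge-injective H (++-injectiveˡ (edge H i) (edge H j) eq)
  }
  where H = hypergraph G

star : (k : ℕ) → Graph (suc k)
star k = record
  { hypergraph = record
    { size           = k
    ; edge           = λ i → inside ∷ ⁅ i ⁆
    ; edge-injective = λ {i} {j} eq →
        x∈⁅y⁆⇒x≡y j (subst (i ∈_) (∷-injectiveʳ eq) (x∈⁅x⁆ i))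
    }
  ; 2-uniform = λ i → cong suc (∣⁅x⁆∣≡1 i)
  }

Admissible : ℕ → Hypergraph m → Hypergraph n → Set
Admissible r F H = Uniform r H × Linear H × Free F H

Attained : ℕ → (n : ℕ) → Hypergraph m → ℕ → Set
Attained r n F q = ∃[ H ] Admissible {n = n} r F H × size H ≡ q

private
  Searchable : Set → Set₁
  Searchable A = {P : Pred A 0ℓ} → Decidable P → Dec (∃ P)

  anyVec? : ∀ {A} → Searchable A → ∀ q → Searchable (Vec A q)
  anyVec? any zero    P? = map′ ([] ,_) (λ { ([] , p) → p }) (P? [])
  anyVec? any (suc q) P? =
    map′ (λ (x , xs , p) → x ∷ xs , p) (λ { (x ∷ xs , p) → x , xs , p })
         (any λ x → anyVec? any q λ xs → P? (x ∷ xs))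

  _≟ˢ_ : DecidableEquality (Subset n)
  _≟ˢ_ = ≡-dec Bool._≟_

  injective? : {A : Set} → DecidableEquality A → (f : Fin m → A) → Dec (Injective _≡_ _≡_ f)
  injective? _≟′_ f =
    map′ (λ inj {x} {y} → inj x y) (λ inj x y → inj {x} {y})
         (all? λ x → all? λ y → (f x ≟′ f y) →-dec (x ≟ y))

  image-cong : {f g : Fin m → Fin n} → f ≗ g → ∀ p → image f p ≡ image g p
  image-cong {m} {n} {f} {g} f≗g p = tabulate-cong (λ w → does-cong w)
    where
    does-cong : ∀ w → does (any? λ v → (v ∈? p) ×-dec (f v ≟ w))
                    ≡ does (any? λ v → (v ∈? p) ×-dec (g v ≟ w))
    does-cong w with any? (λ v → (v ∈? p) ×-dec (f v ≟ w)) | any? (λ v → (v ∈? p) ×-dec (g v ≟ w))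
    ... | yes _              | yes _ = refl
    ... | no  _              | no  _ = refl
    ... | yes (v , v∈p , eq) | no ¬q = contradiction (v , v∈p , trans (sym (f≗g v)) eq) ¬q
    ... | no ¬p              | yes (v , v∈p , eq) = contradiction (v , v∈p , trans (f≗g v) eq) ¬p

  contains? : (H : Hypergraph n) (F : Hypergraph m) → Dec (Contains H F)
  contains? {n} {m} H F =
    map′ (λ (xs , inj , emb) → lookup xs , inj , emb) to
      (anyVec? any? m λ xs →
        injective? _≟_ (lookup xs) ×-dec
        all? λ i → any? λ j → image (lookup xs) (edge F i) ≟ˢ edge H j)
    where
    to : Contains H F →
         ∃[ xs ] Injective _≡_ _≡_ (lookup xs) ×
                 (∀ i → ∃[ j ] image {m} {n} (lookup xs) (edge F i) ≡ edge H j)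
    to (f , inj , emb) =
      tabulate f ,
      (λ {x} {y} eq → inj (trans (sym (f′≗f x)) (trans eq (f′≗f y)))) ,
      λ i → proj₁ (emb i) , trans (image-cong f′≗f (edge F i)) (proj₂ (emb i))
      where f′≗f = lookup∘tabulate f

  admissible? : ∀ r (F : Hypergraph m) → Decidable (Admissible {n = n} r F)
  admissible? r F H =
    all? (λ i → ∣ edge H i ∣ ℕ.≟ r) ×-dec
    (all? λ i → all? λ j → ¬? (i ≟ j) →-dec (∣ edge H i ∩ edge H j ∣ ℕ.≤? 1)) ×-dec
    ¬? (contains? H F)

  fromVec : (es : Vec (Subset n) q) → Injective _≡_ _≡_ (lookup es) → Hypergraph n
  fromVec es inj = record { size = _ ; edge = lookup es ; edge-injective = inj }

attained? : ∀ r n (F : Hypergraph m) → Decidable (Attained r n F)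
attained? r n F q = map′ from to (anyVec? anySubset? q P?)
  where
  P : Vec (Subset n) q → Set
  P es = Σ (Injective _≡_ _≡_ (lookup es)) λ inj → Admissible r F (fromVec es inj)

  P? : Decidable P
  P? es with injective? _≟ˢ_ (lookup es)
  ... | no ¬inj = no (λ (inj , _) → ¬inj λ {x} {y} → inj {x} {y})
  ... | yes inj = map′ (λ adm → (λ {x} {y} → inj {x} {y}) , adm) proj₂
                       (admissible? r F (fromVec es inj))

  from : ∃ P → Attained r n F q
  from (es , inj , adm) = fromVec es inj , adm , refl

  to : Attained r n F q → ∃ P
  to (H , (uni , lin , free) , refl) =
    tabulate (edge H) ,
    (λ {i} {j} e → edge-injective H (trans (sym (eq i)) (trans e (eq j)))) ,
    (λ i → trans (cong ∣_∣ (eq i)) (uni i)) ,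
    (λ i j i≢j → subst₂ (λ x y → ∣ x ∩ y ∣ ≤ 1) (sym (eq i)) (sym (eq j)) (lin i j i≢j)) ,
    (λ (f , inj , emb) → free (f , inj , λ i → proj₁ (emb i) , trans (proj₂ (emb i)) (eq _)))
    where eq = lookup∘tabulate (edge H)

-- The largest q ≤ b satisfying P (and 0 if there is none).
largest : {P : ℕ → Set} → Decidable P → ℕ → ℕ
largest P? zero    = zero
largest P? (suc b) = if does (P? (suc b)) then suc b else largest P? b

-- A hypergraph on n vertices has at most 2 ^ n hyperedges, so the search range
-- loses nothing: exˡⁱⁿ-upper and exˡⁱⁿ-attained say this is the maximum. If no
-- hypergraph is admissible (possible only for F without hyperedges) the value is 0.
exˡⁱⁿ : (r n : ℕ) → Hypergraph m → ℕ
exˡⁱⁿ r n F = largest (attained? r n F) (2 ^ n)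

private
  largest-upper : {P : ℕ → Set} (P? : Decidable P) → ∀ b {q} → q ≤ b → P q → q ≤ largest P? b
  largest-upper P? zero    q≤b _ = q≤b
  largest-upper P? (suc b) q≤b p with P? (suc b) | ℕ.m≤n⇒m<n∨m≡n q≤b
  ... | yes _ | _             = q≤b
  ... | no _  | inj₁ q<1+b    = largest-upper P? b (ℕ.≤-pred q<1+b) p
  ... | no ¬p | inj₂ refl     = contradiction p ¬p

  largest-attained : {P : ℕ → Set} (P? : Decidable P) → ∀ b {q} → q ≤ b → P q → P (largest P? b)
  largest-attained P? zero    z≤n p = p
  largest-attained P? (suc b) q≤b p with P? (suc b) | ℕ.m≤n⇒m<n∨m≡n q≤b
  ... | yes p′ | _          = p′
  ... | no _   | inj₁ q<1+b = largest-attained P? b (ℕ.≤-pred q<1+b) p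
  ... | no ¬p  | inj₂ refl  = contradiction p ¬p

  bit : Bool → Fin 2
  bit b = if b then suc zero else zero

  bit-injective : Injective _≡_ _≡_ bit
  bit-injective {false} {false} _ = refl
  bit-injective {true}  {true}  _ = refl

  code : Subset n → Fin (2 ^ n)
  code p = funToFin (bit ∘ lookup p)

  code-injective : Injective _≡_ _≡_ (code {n})
  code-injective {n} {p} {p′} eq = begin
    p                    ≡⟨ tabulate∘lookup p ⟨
    tabulate (lookup p)  ≡⟨ tabulate-cong (λ i → bit-injective (same i)) ⟩
    tabulate (lookup p′) ≡⟨ tabulate∘lookup p′ ⟩
    p′                   ∎
    where
    open ≡-Reasoning
    same : ∀ i → bit (lookup p i) ≡ bit (lookup p′ i)
    same i = begin
      bit (lookup p i)       ≡⟨ finToFun-funToFin (bit ∘ lookup p) i ⟨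
      finToFun (code p) i    ≡⟨ cong (λ c → finToFun c i) eq ⟩
      finToFun (code p′) i   ≡⟨ finToFun-funToFin (bit ∘ lookup p′) i ⟩
      bit (lookup p′ i)      ∎

size≤2^n : (H : Hypergraph n) → size H ≤ 2 ^ n
size≤2^n H = injective⇒≤ {f = code ∘ edge H} (edge-injective H ∘ code-injective)

exˡⁱⁿ-upper : ∀ r (F : Hypergraph m) (H : Hypergraph n) →
              Admissible r F H → size H ≤ exˡⁱⁿ r n F
exˡⁱⁿ-upper r F H adm =
  largest-upper (attained? r _ F) _ (size≤2^n H) (H , adm , refl)

exˡⁱⁿ-attained : ∀ r (F : Hypergraph m) (H : Hypergraph n) →
                 Admissible r F H → Attained r n F (exˡⁱⁿ r n F)
exˡⁱⁿ-attained r F H adm =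
  largest-attained (attained? r _ F) _ (size≤2^n H) (H , adm , refl)

{-# OPTIONS --safe #-}

-- Counting incidences gives r |E(H)| = Σ_v d(v). In a linear r-uniform H with
-- r ≥ 2, the hyperedges through a vertex v are disjoint outside v, so k of them
-- form a copy of S_k^r; conversely a copy of S_k^r forces degree ≥ k at the image
-- of its centre. Hence H is S_k^r-free iff all degrees are at most k - 1, and
-- then Σ_v d(v) ≤ n (k - 1), with equality iff every degree is k - 1.

module Submission where

open import Data.Integer using (+_)
open import Data.Nat using (ℕ; NonZero; _*_; _∸_; _≤_)
open import Data.Product using (_×_; ∃-syntax)
open import Data.Rational using (_/_) renaming (_≤_ to _≤ℚ_)
open import Function using (_⇔_)
open import Relation.Binary.PropositionalEquality using (_≡_)
open import Defs

open import Data.Bool using (Bool; if_then_else_)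
open import Data.Fin
  using (Fin; zero; suc; _↑ˡ_; _↑ʳ_; splitAt; combine; remQuot; punchIn; punchOut; inject≤)
open import Data.Fin.Properties
  using ( _≟_; any?; suc-injective; injective⇒≤; inject≤-injective; splitAt-↑ˡ; splitAt-↑ʳ
        ; splitAt⁻¹-↑ˡ; splitAt⁻¹-↑ʳ; remQuot-combine; combine-remQuot; punchIn-injective; punchInᵢ≢i
        ; punchIn-punchOut)
open import Data.Fin.Subset using (Subset; inside; outside; _∈_; _⊆_; _∩_; ∣_∣; ⁅_⁆)
open import Data.Fin.Subset.Properties
  using (_∈?_; x∈⁅x⁆; x∈⁅y⁆⇒x≡y; x∈p∩q⁺; ⊆-antisym)
import Data.Integer as ℤ
import Data.Integer.Properties as ℤ
open import Data.Nat using (zero; suc; _+_; z≤n; s≤s)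
open import Data.Nat.Properties hiding (_≟_; suc-injective)
open import Algebra.Properties.CommutativeMonoid.Sum +-0-commutativeMonoid
  using (sum; sum-cong-≗; ∑-comm)
open import Data.Product using (_,_; proj₁; proj₂)
import Data.Rational.Properties as ℚ
open import Data.Rational.Unnormalised using (mkℚᵘ; *≡*; *≤*)
import Data.Rational.Unnormalised.Properties as ℚᵘ
open import Data.Sum using (_⊎_; inj₁; inj₂; [_,_]′)
open import Data.Vec using ([]; _∷_; lookup; map; replicate; here; there)
open import Data.Vec.Properties
  using ( lookup∘tabulate; lookup-++ˡ; lookup-++ʳ; lookup-concat; lookup-map; lookup-replicate
        ; []=⇒lookup; lookup⇒[]=)
open import Function using (_∘_; mk⇔)
open import Function.Definitions using (Injective)
open import Relation.Binary.PropositionalEquality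
  using (_≢_; refl; sym; trans; cong; subst; subst₂; module ≡-Reasoning)
open import Relation.Nullary using (does; yes; no; contradiction; _×-dec_)
open import Relation.Nullary.Decidable using (dec-true)

private
  variable
    k m n q s : ℕ

-- Fractions in `ℚ` and products in `ℕ`

-- `_/_` reduces to lowest terms, so the comparison is made between unnormalised rationals, where
-- the order is cross-multiplication.
/1≤/⁺ : ∀ a b r .{{_ : NonZero r}} → a * r ≤ b → + a / 1 ≤ℚ + b / r
/1≤/⁺ a b r@(suc d) ar≤b = ℚ.toℚᵘ-cancel-≤
  (ℚᵘ.≤-respˡ-≃ (ℚᵘ.≃-sym (ℚ.toℚᵘ-fromℚᵘ (mkℚᵘ (+ a) 0)))
    (ℚᵘ.≤-respʳ-≃ (ℚᵘ.≃-sym (ℚ.toℚᵘ-fromℚᵘ (mkℚᵘ (+ b) d)))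
      (*≤* (subst₂ ℤ._≤_ (ℤ.pos-* a r) (sym (ℤ.*-identityʳ (+ b))) (ℤ.+≤+ ar≤b)))))

/1≡/⁺ : ∀ a b r .{{_ : NonZero r}} → a * r ≡ b → + a / 1 ≡ + b / r
/1≡/⁺ a b r@(suc d) ar≡b = ℚ.fromℚᵘ-cong {mkℚᵘ (+ a) 0} {mkℚᵘ (+ b) d}
  (*≡* (trans (sym (ℤ.pos-* a r)) (trans (cong +_ ar≡b) (sym (ℤ.*-identityʳ (+ b))))))

/1≡/⁻ : ∀ a b r .{{_ : NonZero r}} → + a / 1 ≡ + b / r → a * r ≡ b
/1≡/⁻ a b r@(suc d) eq with ℚ.fromℚᵘ-injective {mkℚᵘ (+ a) 0} {mkℚᵘ (+ b) d} eq
... | *≡* ar≡b = ℤ.+-injective (trans (ℤ.pos-* a r) (trans ar≡b (ℤ.*-identityʳ (+ b))))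

-- Sums with bounded terms

sum-const : ∀ {f : Fin n → ℕ} {c} → (∀ i → f i ≡ c) → sum f ≡ n * c
sum-const {zero}  f≡c = refl
sum-const {suc n} {c = c} f≡c rewrite f≡c zero = cong (λ x → c + x) (sum-const (f≡c ∘ suc))

sum-bounded : ∀ {f : Fin n → ℕ} {c} → (∀ i → f i ≤ c) → sum f ≤ n * c
sum-bounded {zero}  f≤c = z≤n
sum-bounded {suc n} f≤c = +-mono-≤ (f≤c zero) (sum-bounded (f≤c ∘ suc))

-- The tail contributes at most `n * c`, which forces the head up to `c`; the head contributes at
-- most `c`, so the tail attains its own bound and the induction continues.
sum-bounded-tight : ∀ {f : Fin n → ℕ} {c} → (∀ i → f i ≤ c) → n * c ≤ sum f → ∀ i → f i ≡ c
sum-bounded-tight {suc n} {f} {c} f≤c nc≤Σ zero = ≤-antisym (f≤c zero)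
  (+-cancelʳ-≤ (n * c) c (f zero)
    (≤-trans nc≤Σ (+-monoʳ-≤ (f zero) (sum-bounded (f≤c ∘ suc)))))
sum-bounded-tight {suc n} {f} {c} f≤c nc≤Σ (suc i) = sum-bounded-tight (f≤c ∘ suc)
  (+-cancelˡ-≤ c (n * c) _ (≤-trans nc≤Σ (+-monoˡ-≤ _ (f≤c zero)))) i

indicator : Bool → ℕ
indicator b = if b then 1 else 0

∣p∣≡sum : (p : Subset n) → ∣ p ∣ ≡ sum (indicator ∘ lookup p)
∣p∣≡sum []            = refl
∣p∣≡sum (inside ∷ p)  = cong suc (∣p∣≡sum p)
∣p∣≡sum (outside ∷ p) = ∣p∣≡sum p

-- Enumerating the elements of a subset

-- The length `q` is a separate index so that uniformity can transport an enumeration of a hyperedge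
-- to the length `r`.
record Enumeration (p : Subset n) (q : ℕ) : Set where
  field
    at           : Fin q → Fin n
    at-injective : Injective _≡_ _≡_ at
    at-∈         : ∀ i → at i ∈ p
    index        : ∀ {x} → x ∈ p → ∃[ i ] at i ≡ x

open Enumeration

enumerate : (p : Subset n) → Enumeration p ∣ p ∣
enumerate [] = record
  { at = λ () ; at-injective = λ { {()} } ; at-∈ = λ () ; index = λ () }
enumerate (outside ∷ p) = record
  { at           = suc ∘ at e
  ; at-injective = λ eq → at-injective e (suc-injective eq)
  ; at-∈         = there ∘ at-∈ e
  ; index        = λ { (there x∈p) → proj₁ (index e x∈p) , cong suc (proj₂ (index e x∈p)) }
  }
  where e = enumerate p
enumerate (inside ∷ p) = record
  { at           = λ { zero → zero ; (suc i) → suc (at e i) }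
  ; at-injective = λ { {zero} {zero} _ → refl
                     ; {suc i} {suc j} eq → cong suc (at-injective e (suc-injective eq)) }
  ; at-∈         = λ { zero → here ; (suc i) → there (at-∈ e i) }
  ; index        = λ { here → zero , refl
                     ; (there x∈p) → suc (proj₁ (index e x∈p)) , cong suc (proj₂ (index e x∈p)) }
  }
  where e = enumerate p

index-injective : {p : Subset n} (e : Enumeration p q) {x y : Fin n} (x∈p : x ∈ p) (y∈p : y ∈ p) →
                  proj₁ (index e x∈p) ≡ proj₁ (index e y∈p) → x ≡ y
index-injective e x∈p y∈p eq =
  trans (sym (proj₂ (index e x∈p))) (trans (cong (at e) eq) (proj₂ (index e y∈p)))

injective⇒≤∣p∣ : {p : Subset n} (f : Fin k → Fin n) → Injective _≡_ _≡_ f → (∀ i → f i ∈ p) →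
                 k ≤ ∣ p ∣
injective⇒≤∣p∣ {p = p} f f-inj f∈p = injective⇒≤ {f = λ i → proj₁ (index (enumerate p) (f∈p i))}
  (λ {i} {j} eq → f-inj (index-injective (enumerate p) (f∈p i) (f∈p j) eq))

-- The positions of `x` and `y` become equal once injected into `Fin 1`. This is the form in which
-- linearity is applied to the intersection of two hyperedges.
∣p∣≤1⇒≡ : {p : Subset n} {x y : Fin n} → ∣ p ∣ ≤ 1 → x ∈ p → y ∈ p → x ≡ y
∣p∣≤1⇒≡ {p = p} ∣p∣≤1 x∈p y∈p =
  index-injective (enumerate p) x∈p y∈p (inject≤-injective ∣p∣≤1 ∣p∣≤1 _ _ (Fin1-irrelevant _ _))
  where
  Fin1-irrelevant : (i j : Fin 1) → i ≡ j
  Fin1-irrelevant zero zero = refl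

-- Images, incidence and the degree sum

∈-image⁺ : (f : Fin m → Fin n) {p : Subset m} {v : Fin m} → v ∈ p → f v ∈ image f p
∈-image⁺ f {p} {v} v∈p = lookup⇒[]= (f v) (image f p)
  (trans (lookup∘tabulate _ (f v))
         (dec-true (any? λ u → (u ∈? p) ×-dec (f u ≟ f v)) (v , v∈p , refl)))

∈-image⁻ : (f : Fin m → Fin n) {p : Subset m} {w : Fin n} → w ∈ image f p →
           ∃[ v ] v ∈ p × f v ≡ w
∈-image⁻ f {p} {w} w∈ with any? (λ v → (v ∈? p) ×-dec (f v ≟ w)) in eq
... | yes found = found
... | no  _     = contradiction
  (trans (cong does (sym eq)) (trans (sym (lookup∘tabulate _ w)) ([]=⇒lookup w∈))) λ ()

∈-incident⁺ : (H : Hypergraph n) {v : Fin n} {i : Fin (size H)} → v ∈ edge H i → i ∈ incident H v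
∈-incident⁺ H {v} {i} v∈e =
  lookup⇒[]= i (incident H v) (trans (lookup∘tabulate _ i) ([]=⇒lookup v∈e))

∈-incident⁻ : (H : Hypergraph n) {v : Fin n} {i : Fin (size H)} → i ∈ incident H v → v ∈ edge H i
∈-incident⁻ H {v} {i} i∈v =
  lookup⇒[]= v (edge H i) (trans (sym (lookup∘tabulate _ i)) ([]=⇒lookup i∈v))

-- Double counting in the 0/1 incidence matrix: summing over hyperedges first gives degrees, summing
-- over vertices first gives hyperedge sizes.
sum-degree : ∀ r (H : Hypergraph n) → Uniform r H → sum (degree H) ≡ size H * r
sum-degree r H uniform = begin
  sum (degree H)
    ≡⟨ sum-cong-≗ (λ v → trans (∣p∣≡sum (incident H v))
                               (sum-cong-≗ {n = size H} λ i →
                                 cong indicator (lookup∘tabulate (λ i → lookup (edge H i) v) i))) ⟩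
  sum (λ v → sum λ i → indicator (lookup (edge H i) v))
    ≡⟨ ∑-comm (λ v i → indicator (lookup (edge H i) v)) ⟩
  sum (λ i → sum λ v → indicator (lookup (edge H i) v))
    ≡⟨ sum-const (λ i → trans (sym (∣p∣≡sum (edge H i))) (uniform i)) ⟩
  size H * r ∎
  where open ≡-Reasoning

-- Vertices and hyperedges of the expanded star

-- The i-th hyperedge of S_k^r, r = s + 2, consists of the centre and the s + 1
-- vertices leaf i t; leaf i zero is a vertex of S_k, the others are new.
leaf : Fin k → Fin (suc s) → Fin (suc k + k * s)
leaf {k} {s} i zero    = suc i ↑ˡ (k * s)
leaf {k} {s} i (suc t) = suc k ↑ʳ combine i t

-- A view of the vertex set, so that later proofs split on centre or leaf instead of on `splitAt`
-- and `remQuot`.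
data StarVertex (k s : ℕ) : Fin (suc k + k * s) → Set where
  centre : StarVertex k s zero
  isLeaf : ∀ i t → StarVertex k s (leaf {k} {s} i t)

starVertex : ∀ k s (x : Fin (suc k + k * s)) → StarVertex k s x
starVertex k s x with splitAt (suc k) x in eq
... | inj₁ zero    = subst (StarVertex k s) (splitAt⁻¹-↑ˡ eq) centre
... | inj₁ (suc i) = subst (StarVertex k s) (splitAt⁻¹-↑ˡ eq) (isLeaf i zero)
... | inj₂ y       = subst (StarVertex k s)
  (trans (cong (suc k ↑ʳ_) (combine-remQuot {k} s y)) (splitAt⁻¹-↑ʳ eq))
  (isLeaf (proj₁ (remQuot {k} s y)) (suc (proj₂ (remQuot {k} s y))))

starEdge : ∀ k s → Fin k → Subset (suc k + k * s)
starEdge k s = edge (expansion (suc (suc s)) (star k))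

-- The bit of `⁅ i ⁆` at `j` occurs once in the star part and is repeated `s` times in `block s i`;
-- every leaf of `j` reads one of these copies.
lookup-starEdge-leaf : (i j : Fin k) (t : Fin (suc s)) →
                       lookup (starEdge k s i) (leaf {k} {s} j t) ≡ lookup ⁅ i ⁆ j
lookup-starEdge-leaf {k} {s} i j zero    = lookup-++ˡ (inside ∷ ⁅ i ⁆) (block s i) (suc j)
lookup-starEdge-leaf {k} {s} i j (suc t) = begin
  lookup (starEdge k s i) (suc k ↑ʳ combine j t)
    ≡⟨ lookup-++ʳ (inside ∷ ⁅ i ⁆) (block s i) (combine j t) ⟩
  lookup (block s i) (combine j t)
    ≡⟨ lookup-concat (map (replicate s) ⁅ i ⁆) j t ⟩
  lookup (lookup (map (replicate s) ⁅ i ⁆) j) t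
    ≡⟨ cong (λ xs → lookup xs t) (lookup-map j (replicate s) ⁅ i ⁆) ⟩
  lookup (replicate s (lookup ⁅ i ⁆ j)) t
    ≡⟨ lookup-replicate t _ ⟩
  lookup ⁅ i ⁆ j ∎
  where open ≡-Reasoning

leaf∈starEdge : (i : Fin k) (t : Fin (suc s)) → leaf {k} {s} i t ∈ starEdge k s i
leaf∈starEdge {k} {s} i t = lookup⇒[]= (leaf i t) (starEdge k s i)
  (trans (lookup-starEdge-leaf i i t) ([]=⇒lookup (x∈⁅x⁆ i)))

leaf∈starEdge⇒≡ : (i j : Fin k) (t : Fin (suc s)) → leaf {k} {s} j t ∈ starEdge k s i → j ≡ i
leaf∈starEdge⇒≡ i j t leaf∈ = x∈⁅y⁆⇒x≡y i
  (lookup⇒[]= j ⁅ i ⁆ (trans (sym (lookup-starEdge-leaf i j t)) ([]=⇒lookup leaf∈)))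

-- Building a copy of the expanded star

starMap : Fin n → (Fin k → Fin (suc s) → Fin n) → Fin (suc k + k * s) → Fin n
starMap {k = k} {s} v g x =
  [ (λ { zero → v ; (suc i) → g i zero })
  , (λ y → g (proj₁ (remQuot {k} s y)) (suc (proj₂ (remQuot {k} s y)))) ]′ (splitAt (suc k) x)

starMap-leaf : (v : Fin n) (g : Fin k → Fin (suc s) → Fin n) →
               ∀ i t → starMap v g (leaf i t) ≡ g i t
starMap-leaf {k = k} {s} v g i zero    rewrite splitAt-↑ˡ (suc k) (suc i) (k * s) = refl
starMap-leaf {k = k} {s} v g i (suc t)
  rewrite splitAt-↑ʳ (suc k) (k * s) (combine i t) =
  cong (λ it → g (proj₁ it) (suc (proj₂ it))) (remQuot-combine {k} {s} i t)

-- Reduces an embedding to listings `g i` of the hyperedges `e i` without `v`. The injectivity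
-- hypothesis covers all listings at once, so it also encodes disjointness outside `v`; its
-- conclusion is the equality that injectivity of `starMap` asks for.
contains-star : (H : Hypergraph n) (v : Fin n) (e : Fin k → Fin (size H))
                (g : Fin k → Fin (suc s) → Fin n) →
                (∀ i t → g i t ≢ v) →
                (∀ {i j t u} → g i t ≡ g j u → leaf {k} {s} i t ≡ leaf j u) →
                (∀ i → v ∈ edge H (e i)) → (∀ i t → g i t ∈ edge H (e i)) →
                (∀ i {x} → x ∈ edge H (e i) → x ≡ v ⊎ ∃[ t ] g i t ≡ x) →
                Contains H (expansion (suc (suc s)) (star k))
contains-star {k = k} {s} H v e g g≢v g-inj v∈ g∈ cover = f , f-injective , λ i → e i , image≡ i
  where
  f = starMap v g

  f-leaf = starMap-leaf v g

  f-injective : Injective _≡_ _≡_ f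
  f-injective {x} {y} eq with starVertex k s x | starVertex k s y
  ... | centre     | centre     = refl
  ... | centre     | isLeaf i t = contradiction (trans (sym (f-leaf i t)) (sym eq)) (g≢v i t)
  ... | isLeaf i t | centre     = contradiction (trans (sym (f-leaf i t)) eq) (g≢v i t)
  ... | isLeaf i t | isLeaf j u = g-inj (trans (sym (f-leaf i t)) (trans eq (f-leaf j u)))

  image⊆ : ∀ i → image f (starEdge k s i) ⊆ edge H (e i)
  image⊆ i w∈ with ∈-image⁻ f w∈
  ... | x , x∈ , refl with starVertex k s x
  ... | centre = v∈ i
  ... | isLeaf j t with refl ← leaf∈starEdge⇒≡ i j t x∈ =
    subst (_∈ edge H (e i)) (sym (f-leaf i t)) (g∈ i t)

  ⊆image : ∀ i → edge H (e i) ⊆ image f (starEdge k s i)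
  ⊆image i x∈ with cover i x∈
  -- The centre is vertex `zero`, which `f` sends to `v`, and every star hyperedge starts with
  -- `inside`.
  ... | inj₁ refl       = ∈-image⁺ f here
  ... | inj₂ (t , refl) =
    subst (_∈ image f (starEdge k s i)) (f-leaf i t) (∈-image⁺ f (leaf∈starEdge i t))

  image≡ : ∀ i → image f (starEdge k s i) ≡ edge H (e i)
  image≡ i = ⊆-antisym (image⊆ i) (⊆image i)

-- Large degree and containing a star

degree≥k⇒contains-star : (H : Hypergraph n) → Linear H → Uniform (suc (suc s)) H →
                         ∀ v → k ≤ degree H v → Contains H (expansion (suc (suc s)) (star k))
degree≥k⇒contains-star {n} {s} {k} H linear uniform v k≤d =
  contains-star H v e g g≢v g-inj v∈ (λ i t → at-∈ (members i) _) cover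
  where
  through = enumerate (incident H v)

  e : Fin k → Fin (size H)
  e i = at through (inject≤ i k≤d)

  e-injective : Injective _≡_ _≡_ e
  e-injective eq = inject≤-injective k≤d k≤d _ _ (at-injective through eq)

  v∈ : ∀ i → v ∈ edge H (e i)
  v∈ i = ∈-incident⁻ H (at-∈ through _)

  members : ∀ i → Enumeration (edge H (e i)) (suc (suc s))
  members i = subst (Enumeration _) (uniform (e i)) (enumerate (edge H (e i)))

  pivot : Fin k → Fin (suc (suc s))
  pivot i = proj₁ (index (members i) (v∈ i))

  at-pivot : ∀ i → at (members i) (pivot i) ≡ v
  at-pivot i = proj₂ (index (members i) (v∈ i))

  -- `punchIn` skips the position of `v`, leaving the other `s + 1` vertices of the hyperedge.
  g : Fin k → Fin (suc s) → Fin n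
  g i t = at (members i) (punchIn (pivot i) t)

  g≢v : ∀ i t → g i t ≢ v
  g≢v i t eq = punchInᵢ≢i (pivot i) t (at-injective (members i) (trans eq (sym (at-pivot i))))

  g-inj : ∀ {i j t u} → g i t ≡ g j u → leaf {k} {s} i t ≡ leaf j u
  g-inj {i} {j} {t} {u} eq with i ≟ j
  ... | yes refl = cong (leaf i) (punchIn-injective (pivot i) t u (at-injective (members i) eq))
  -- A leaf common to two distinct hyperedges would lie with `v` in an intersection of size at most
  -- one, hence equal `v`.
  ... | no  i≢j  = contradiction
    (∣p∣≤1⇒≡ (linear (e i) (e j) (i≢j ∘ e-injective))
      (x∈p∩q⁺ (at-∈ (members i) _ , subst (_∈ edge H (e j)) (sym eq) (at-∈ (members j) _)))
      (x∈p∩q⁺ (v∈ i , v∈ j)))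
    (g≢v i t)

  cover : ∀ i {x} → x ∈ edge H (e i) → x ≡ v ⊎ ∃[ t ] g i t ≡ x
  cover i x∈ with index (members i) x∈
  ... | y , refl with pivot i ≟ y
  ... | yes refl = inj₁ (at-pivot i)
  ... | no  c≢y  = inj₂ (punchOut c≢y , cong (at (members i)) (punchIn-punchOut c≢y))

contains-star⇒degree≥k : (H : Hypergraph n) → Contains H (expansion (suc (suc s)) (star k)) →
                         ∃[ v ] k ≤ degree H v
contains-star⇒degree≥k {s = s} {k} H (f , f-inj , emb) =
  f zero , injective⇒≤∣p∣ (proj₁ ∘ emb) j-injective
    (λ i → ∈-incident⁺ H (subst (f zero ∈_) (proj₂ (emb i)) (∈-image⁺ f here)))
  where
  j-injective : Injective _≡_ _≡_ (proj₁ ∘ emb)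
  -- If star hyperedges `i` and `i′` had the same image, injectivity of `f` would place
  -- `leaf i zero` in hyperedge `i′`. This leaf exists for every `s`, including `s = 0`.
  j-injective {i} {i′} eq with ∈-image⁻ f (subst (f (leaf i zero) ∈_)
      (trans (proj₂ (emb i)) (trans (cong (edge H) eq) (sym (proj₂ (emb i′)))))
      (∈-image⁺ f (leaf∈starEdge {s = s} i zero)))
  ... | x , x∈ , fx≡ = leaf∈starEdge⇒≡ i′ i zero (subst (_∈ starEdge k s i′) (f-inj fx≡) x∈)

-- Star-free hypergraphs and the extremal number

free⇒degree≤ : ∀ (H : Hypergraph n) → Linear H → Uniform (suc (suc s)) H →
               Free (expansion (suc (suc s)) (star (suc k))) H → ∀ v → degree H v ≤ k
free⇒degree≤ H linear uniform free v =
  -- `k < degree H v` unfolds to `suc k ≤ degree H v`, exactly enough hyperedges for `star (suc k)`.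
  ≮⇒≥ (free ∘ degree≥k⇒contains-star H linear uniform v)

free⇒size*r≤ : ∀ (H : Hypergraph n) →
               Admissible (suc (suc s)) (expansion (suc (suc s)) (star (suc k))) H →
               size H * suc (suc s) ≤ n * k
free⇒size*r≤ {n} {s} {k} H (uniform , linear , free) =
  subst (_≤ n * k) (sum-degree _ H uniform) (sum-bounded (free⇒degree≤ H linear uniform free))

free-extremal⇒regular : ∀ (H : Hypergraph n) → Linear H → Uniform (suc (suc s)) H →
                        Free (expansion (suc (suc s)) (star (suc k))) H →
                        size H * suc (suc s) ≡ n * k → Regular k H
free-extremal⇒regular H linear uniform free eq =
  sum-bounded-tight (free⇒degree≤ H linear uniform free)
    (≤-reflexive (trans (sym eq) (sym (sum-degree _ H uniform))))

regular⇒free : ∀ (H : Hypergraph n) → Regular k H →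
               Free (expansion (suc (suc s)) (star (suc k))) H
regular⇒free H regular c with contains-star⇒degree≥k H c
... | v , k<d = <-irrefl (sym (regular v)) k<d

regular⇒size*r≡ : ∀ r (H : Hypergraph n) → Uniform r H → Regular k H → size H * r ≡ n * k
regular⇒size*r≡ r H uniform regular = trans (sym (sum-degree r H uniform)) (sum-const regular)

edgeless : ∀ n → Hypergraph n
edgeless n = record { size = 0 ; edge = λ () ; edge-injective = λ { {()} } }

-- Provides the admissible hypergraph from which `exˡⁱⁿ-attained` concludes that the maximum is
-- attained. The star has at least one edge, which has no possible image here.
edgeless-admissible : ∀ {r} n → Admissible r (expansion r (star (suc k))) (edgeless n)
edgeless-admissible n = (λ ()) , (λ ()) , λ { (_ , _ , emb) → contradiction (proj₁ (emb zero)) λ () }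

-- Stated for an arbitrary maximum q, so that the typechecker never unfolds the
-- search defining exˡⁱⁿ.
star-maximum : ∀ s k n q → let r = suc (suc s) ; F = expansion r (star (suc k)) in
               Attained r n F q → (∀ (H : Hypergraph n) → Admissible r F H → size H ≤ q) →
               (+ q / 1 ≤ℚ + (n * k) / r)
               × ((+ q / 1 ≡ + (n * k) / r) ⇔ (∃[ H ] Linear {n} H × Uniform r H × Regular k H))
star-maximum s k n q (H , adm@(uniform , linear , free) , refl) upper =
  /1≤/⁺ q (n * k) r (free⇒size*r≤ H adm) ,
  -- The regular witness is the hypergraph `H` attaining the maximum.
  mk⇔ (λ eq → H , linear , uniform ,
              free-extremal⇒regular H linear uniform free (/1≡/⁻ q (n * k) r eq))
      -- A regular `H′` is star-free, so `size H′ ≤ q`; multiplying by `r` turns this into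
      -- `n * k ≤ q * r`, the reverse of the upper bound.
      (λ (H′ , linear′ , uniform′ , regular′) → /1≡/⁺ q (n * k) r (≤-antisym
        (free⇒size*r≤ H adm)
        (subst (_≤ q * r) (regular⇒size*r≡ r H′ uniform′ regular′)
          (*-monoˡ-≤ r (upper H′ (uniform′ , linear′ , regular⇒free H′ regular′))))))
  where r = suc (suc s)

proposition1 : (r k n : ℕ) .{{_ : NonZero r}} → 3 ≤ r → 1 ≤ k → 1 ≤ n →
    (+ exˡⁱⁿ r n (expansion r (star k)) / 1 ≤ℚ + (n * (k ∸ 1)) / r)
    × ((H : Hypergraph n) → Linear H → Uniform r H →
    (Free (expansion r (star k)) H × + size H / 1 ≡ + (n * (k ∸ 1)) / r)
    ⇔ Regular (k ∸ 1) H)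
    × ((+ exˡⁱⁿ r n (expansion r (star k)) / 1 ≡ + (n * (k ∸ 1)) / r)
    ⇔ (∃[ H ] Linear {n} H × Uniform r H × Regular (k ∸ 1) H))
proposition1 (suc zero) _ _ (s≤s ())
proposition1 r@(suc (suc s)) (suc k) n _ _ _ =
  proj₁ maximum ,
  (λ H linear uniform → mk⇔
    (λ (free , eq) → free-extremal⇒regular H linear uniform free (/1≡/⁻ (size H) (n * k) r eq))
    (λ regular → regular⇒free H regular ,
                 /1≡/⁺ (size H) (n * k) r (regular⇒size*r≡ r H uniform regular))) ,
  proj₂ maximum
  where
  maximum = star-maximum s k n (exˡⁱⁿ r n (expansion r (star (suc k))))
    (exˡⁱⁿ-attained r (expansion r (star (suc k))) (edgeless n) (edgeless-admissible n))
    (exˡⁱⁿ-upper r (expansion r (star (suc k))))
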